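{- Let $S,T$ be as in the context and let $n,k\geq 1$ be natural numbers. If $\mathrm{Pr}_T(x)$ is a $\Sigma_1$ provability predicate of $T$ satisfying $\mathbf{C}$ and $\mathbf{D3}^n_{n+k}$, then $\mathrm{Pr}_T(x)$ does not satisfy $\mathbf{Ros}$.
   Context: $\mathcal{L}_A=\{0,\mathsf{s},+,\times,\leq\}$ is the language of first-order arithmetic, and "formula" means $\mathcal{L}_A$-formula; $\ulcorner\varphi\urcorner$ is the numeral of the Gödel number of $\varphi$. $S$ and $T$ are consistent c.e. extensions of Peano Arithmetic $\mathsf{PA}$ in the language $\mathcal{L}_A$ such that $T$ is stronger than $S$ (every theorem of $S$ is a theorem of $T$; $S=T$ is allowed). A formula $\mathrm{Pr}_T(x)$ is a provability predicate of $T$ if for every formula $\varphi$: $T\vdash\varphi$ if and only if $S\vdash\mathrm{Pr}_T(\ulcorner\varphi\urcorner)$. A $\Sigma_1$ provability predicate is one that is a $\Sigma_1$ formula. Define $\mathrm{Pr}_T^0(\ulcorner\varphi\urcorner)$ to be $\varphi$ and $\mathrm{Pr}_T^{i+1}(\ulcorner\varphi\urcorner)$ to be $\mathrm{Pr}_T(\ulcorner\mathrm{Pr}_T^i(\ulcorner\varphi\urcorner)\urcorner)$. Conditions on $\mathrm{Pr}_T(x)$: - $\mathbf{C}$: $S\vdash\mathrm{Pr}_T(\ulcorner\varphi\urcorner)\land\mathrm{Pr}_T(\ulcorner\psi\urcorner)\to\mathrm{Pr}_T(\ulcorner\varphi\land\psi\urcorner)$ for all formulas $\varphi,\psi$. -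 $\mathbf{D3}^n_m$: $S\vdash\mathrm{Pr}_T^n(\ulcorner\varphi\urcorner)\to\mathrm{Pr}_T^m(\ulcorner\varphi\urcorner)$ for every formula $\varphi$. - $\mathbf{Ros}$: for every formula $\varphi$, if $T\vdash\neg\varphi$, then $T\vdash\neg\,\mathrm{Pr}_T(\ulcorner\varphi\urcorner)$. -}

module Defs where

open import Data.Fin using (Fin)
open import Data.List using (List; []; _∷_; map)
open import Data.List.Membership.Propositional using (_∈_)
open import Data.Nat using (ℕ; zero; suc; _+_; _*_; _≤_; _<_; s≤s; z≤n)
open import Data.Nat.Properties
open import Data.Product using (∃; _×_; _,_; proj₁; proj₂)
open import Data.Unit using (⊤; tt)
open import Data.Vec using (Vec; []; _∷_; lookup)
open import Function.Bundles using (_⇔_)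
open import Relation.Binary.Definitions using (tri<; tri≈; tri>)
open import Relation.Binary.PropositionalEquality using (_≡_; refl; sym; trans; cong; cong₂)
open import Relation.Nullary using (¬_; contradiction)

infix  9 _[_]
infixl 8 _⊗_
infixl 7 _⊕_
infix  6 _≐_ _≼_
infix  5 ¬∙_ ∀∙_ ∃∙_
infixr 4 _∧_
infixr 3 _∨_
infixr 2 _⇒_
infix  1 _⇔∙_

-- Variables are de Bruijn indices.  The syntax is not scope-indexed: a
-- formula may have any free variables, and index i under d binders
-- denotes the free variable i ∸ d when d ≤ i.
data Term : Set where
  var     : ℕ → Term
  𝟎       : Term
  𝗌       : Term → Term
  _⊕_ _⊗_ : Term → Term → Term

data Formula : Set where
  _≐_ _≼_     : Term → Term → Formula
  falsum      : Formula
  _∧_ _∨_ _⇒_ : Formula → Formula → Formula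
  ∀∙_ ∃∙_     : Formula → Formula

¬∙_ : Formula → Formula
¬∙ φ = φ ⇒ falsum

_⇔∙_ : Formula → Formula → Formula
φ ⇔∙ ψ = (φ ⇒ ψ) ∧ (ψ ⇒ φ)

numeral : ℕ → Term
numeral zero    = 𝟎
numeral (suc n) = 𝗌 (numeral n)

subᵗ : (ℕ → Term) → Term → Term
subᵗ σ (var i) = σ i
subᵗ σ 𝟎       = 𝟎
subᵗ σ (𝗌 t)   = 𝗌 (subᵗ σ t)
subᵗ σ (t ⊕ u) = subᵗ σ t ⊕ subᵗ σ u
subᵗ σ (t ⊗ u) = subᵗ σ t ⊗ subᵗ σ u

↑ᵗ : Term → Term
↑ᵗ = subᵗ (λ i → var (suc i))

lift : (ℕ → Term) → ℕ → Term
lift σ zero    = var zero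
lift σ (suc i) = ↑ᵗ (σ i)

sub : (ℕ → Term) → Formula → Formula
sub σ (t ≐ u) = subᵗ σ t ≐ subᵗ σ u
sub σ (t ≼ u) = subᵗ σ t ≼ subᵗ σ u
sub σ falsum  = falsum
sub σ (φ ∧ ψ) = sub σ φ ∧ sub σ ψ
sub σ (φ ∨ ψ) = sub σ φ ∨ sub σ ψ
sub σ (φ ⇒ ψ) = sub σ φ ⇒ sub σ ψ
sub σ (∀∙ φ)  = ∀∙ sub (lift σ) φ
sub σ (∃∙ φ)  = ∃∙ sub (lift σ) φ

↑ : Formula → Formula
↑ = sub (λ i → var (suc i))

-- Substitute for variable 0 and lower the remaining free variables.
instantiate : Term → ℕ → Term
instantiate t zero    = t
instantiate t (suc i) = var i

_[_] : Formula → Term → Formula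
φ [ t ] = sub (instantiate t) φ

-- Replace variable 0 by its successor, keeping the other variables.
bump : ℕ → Term
bump zero    = 𝗌 (var zero)
bump (suc i) = var (suc i)

-- All free variables have index < k.
Belowᵗ : ℕ → Term → Set
Belowᵗ k (var i) = i < k
Belowᵗ k 𝟎       = ⊤
Belowᵗ k (𝗌 t)   = Belowᵗ k t
Belowᵗ k (t ⊕ u) = Belowᵗ k t × Belowᵗ k u
Belowᵗ k (t ⊗ u) = Belowᵗ k t × Belowᵗ k u

Below : ℕ → Formula → Set
Below k (t ≐ u) = Belowᵗ k t × Belowᵗ k u
Below k (t ≼ u) = Belowᵗ k t × Belowᵗ k u
Below k falsum  = ⊤
Below k (φ ∧ ψ) = Below k φ × Below k ψ
Below k (φ ∨ ψ) = Below k φ × Below k ψ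
Below k (φ ⇒ ψ) = Below k φ × Below k ψ
Below k (∀∙ φ)  = Below (suc k) φ
Below k (∃∙ φ)  = Below (suc k) φ

Sentence : Formula → Set
Sentence = Below 0

data Δ₀ : Formula → Set where
  eq   : ∀ t u → Δ₀ (t ≐ u)
  leq  : ∀ t u → Δ₀ (t ≼ u)
  fls  : Δ₀ falsum
  and  : ∀ {φ ψ} → Δ₀ φ → Δ₀ ψ → Δ₀ (φ ∧ ψ)
  or   : ∀ {φ ψ} → Δ₀ φ → Δ₀ ψ → Δ₀ (φ ∨ ψ)
  imp  : ∀ {φ ψ} → Δ₀ φ → Δ₀ ψ → Δ₀ (φ ⇒ ψ)
  ball : ∀ t {φ} → Δ₀ φ → Δ₀ (∀∙ (var 0 ≼ ↑ᵗ t ⇒ φ))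
  bex  : ∀ t {φ} → Δ₀ φ → Δ₀ (∃∙ (var 0 ≼ ↑ᵗ t ∧ φ))

-- A (possibly empty) block of ∃ in front of a Δ₀ formula.
data Σ₁ : Formula → Set where
  base : ∀ {φ} → Δ₀ φ → Σ₁ φ
  ex   : ∀ {φ} → Σ₁ φ → Σ₁ (∃∙ φ)

record Theory : Set₁ where
  field
    Axiom  : Formula → Set
    closed : ∀ φ → Axiom φ → Sentence φ

open Theory public

infix 0 _∣_⊢_ _⊢_ _⊑_

data _∣_⊢_ (T : Theory) : List Formula → Formula → Set where
  ax  : ∀ {Γ φ} → Axiom T φ → T ∣ Γ ⊢ φ
  hyp : ∀ {Γ φ} → φ ∈ Γ → T ∣ Γ ⊢ φ
  ⇒I  : ∀ {Γ φ ψ} → T ∣ φ ∷ Γ ⊢ ψ → T ∣ Γ ⊢ φ ⇒ ψ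
  ⇒E  : ∀ {Γ φ ψ} → T ∣ Γ ⊢ φ ⇒ ψ → T ∣ Γ ⊢ φ → T ∣ Γ ⊢ ψ
  ∧I  : ∀ {Γ φ ψ} → T ∣ Γ ⊢ φ → T ∣ Γ ⊢ ψ → T ∣ Γ ⊢ φ ∧ ψ
  ∧E₁ : ∀ {Γ φ ψ} → T ∣ Γ ⊢ φ ∧ ψ → T ∣ Γ ⊢ φ
  ∧E₂ : ∀ {Γ φ ψ} → T ∣ Γ ⊢ φ ∧ ψ → T ∣ Γ ⊢ ψ
  ∨I₁ : ∀ {Γ φ ψ} → T ∣ Γ ⊢ φ → T ∣ Γ ⊢ φ ∨ ψ
  ∨I₂ : ∀ {Γ φ ψ} → T ∣ Γ ⊢ ψ → T ∣ Γ ⊢ φ ∨ ψ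
  ∨E  : ∀ {Γ φ ψ χ} → T ∣ Γ ⊢ φ ∨ ψ → T ∣ φ ∷ Γ ⊢ χ → T ∣ ψ ∷ Γ ⊢ χ → T ∣ Γ ⊢ χ
  raa : ∀ {Γ φ} → T ∣ (¬∙ φ) ∷ Γ ⊢ falsum → T ∣ Γ ⊢ φ
  ∀I  : ∀ {Γ φ} → T ∣ map ↑ Γ ⊢ φ → T ∣ Γ ⊢ ∀∙ φ
  ∀E  : ∀ {Γ φ} t → T ∣ Γ ⊢ ∀∙ φ → T ∣ Γ ⊢ φ [ t ]
  ∃I  : ∀ {Γ φ} t → T ∣ Γ ⊢ φ [ t ] → T ∣ Γ ⊢ ∃∙ φ
  ∃E  : ∀ {Γ φ ψ} → T ∣ Γ ⊢ ∃∙ φ → T ∣ φ ∷ map ↑ Γ ⊢ ↑ ψ → T ∣ Γ ⊢ ψ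
  ≐I  : ∀ {Γ} t → T ∣ Γ ⊢ t ≐ t
  ≐E  : ∀ {Γ t u} φ → T ∣ Γ ⊢ t ≐ u → T ∣ Γ ⊢ φ [ t ] → T ∣ Γ ⊢ φ [ u ]

_⊢_ : Theory → Formula → Set
T ⊢ φ = T ∣ [] ⊢ φ

Consistent : Theory → Set
Consistent T = ¬ (T ⊢ falsum)

-- S ⊑ T: T is an extension of (is stronger than) S.
_⊑_ : Theory → Theory → Set
S ⊑ T = ∀ φ → S ⊢ φ → T ⊢ φ

∀^ : ℕ → Formula → Formula
∀^ zero    φ = φ
∀^ (suc k) φ = ∀^ k (∀∙ φ)

Induction : Formula → Formula
Induction φ = φ [ 𝟎 ] ∧ (∀∙ (φ ⇒ sub bump φ)) ⇒ ∀∙ φ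

data PAAxiom : Formula → Set where
  s≢0   : PAAxiom (∀∙ ¬∙ 𝗌 (var 0) ≐ 𝟎)
  s-inj : PAAxiom (∀∙ ∀∙ (𝗌 (var 1) ≐ 𝗌 (var 0) ⇒ var 1 ≐ var 0))
  +0    : PAAxiom (∀∙ var 0 ⊕ 𝟎 ≐ var 0)
  +s    : PAAxiom (∀∙ ∀∙ var 1 ⊕ 𝗌 (var 0) ≐ 𝗌 (var 1 ⊕ var 0))
  ×0    : PAAxiom (∀∙ var 0 ⊗ 𝟎 ≐ 𝟎)
  ×s    : PAAxiom (∀∙ ∀∙ var 1 ⊗ 𝗌 (var 0) ≐ var 1 ⊗ var 0 ⊕ var 1)
  ≤def  : PAAxiom (∀∙ ∀∙ (var 1 ≼ var 0 ⇔∙ ∃∙ var 2 ⊕ var 0 ≐ var 1))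
  -- Any k large enough to bind all parameters of φ is allowed.
  ind   : ∀ φ k → Sentence (∀^ k (Induction φ)) → PAAxiom (∀^ k (Induction φ))

PAAxiom-closed : ∀ φ → PAAxiom φ → Sentence φ
PAAxiom-closed _ s≢0   = (s≤s z≤n , tt) , tt
PAAxiom-closed _ s-inj = (s≤s (s≤s z≤n) , s≤s z≤n) , (s≤s (s≤s z≤n) , s≤s z≤n)
PAAxiom-closed _ +0    = (s≤s z≤n , tt) , s≤s z≤n
PAAxiom-closed _ +s    = (s≤s (s≤s z≤n) , s≤s z≤n) , (s≤s (s≤s z≤n) , s≤s z≤n)
PAAxiom-closed _ ×0    = (s≤s z≤n , tt) , tt
PAAxiom-closed _ ×s    =
  (s≤s (s≤s z≤n) , s≤s z≤n) , ((s≤s (s≤s z≤n) , s≤s z≤n) , s≤s (s≤s z≤n))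
PAAxiom-closed _ ≤def  = (l , r) , (r , l)
  where
  l : 1 < 2 × 0 < 2
  l = s≤s (s≤s z≤n) , s≤s z≤n
  r : (2 < 3 × 0 < 3) × 1 < 3
  r = (s≤s (s≤s (s≤s z≤n)) , s≤s z≤n) , s≤s (s≤s z≤n)
PAAxiom-closed _ (ind _ _ c) = c

PA : Theory
PA = record { Axiom = PAAxiom ; closed = PAAxiom-closed }

-- An injective pairing function: b ≤ a + b, so a + b is the integer
-- square root of the value.
⟨_,_⟩ : ℕ → ℕ → ℕ
⟨ a , b ⟩ = (a + b) * (a + b) + b

-- A term is s⋯s t₀ with t₀ not a successor; its code records the number
-- of leading s together with the tag and the arguments of t₀.
succs : Term → ℕ
succs (𝗌 t) = suc (succs t)
succs _     = 0

tagᵗ : Term → ℕ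
tagᵗ (var _) = 0
tagᵗ 𝟎       = 1
tagᵗ (𝗌 t)   = tagᵗ t
tagᵗ (_ ⊕ _) = 2
tagᵗ (_ ⊗ _) = 3

codeᵗ argsᵗ : Term → ℕ
codeᵗ t = ⟨ succs t , ⟨ tagᵗ t , argsᵗ t ⟩ ⟩
argsᵗ (var i) = i
argsᵗ 𝟎       = 0
argsᵗ (𝗌 t)   = argsᵗ t
argsᵗ (t ⊕ u) = ⟨ codeᵗ t , codeᵗ u ⟩
argsᵗ (t ⊗ u) = ⟨ codeᵗ t , codeᵗ u ⟩

tag : Formula → ℕ
tag (_ ≐ _) = 0
tag (_ ≼ _) = 1
tag falsum  = 2
tag (_ ∧ _) = 3
tag (_ ∨ _) = 4
tag (_ ⇒ _) = 5
tag (∀∙ _)  = 6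
tag (∃∙ _)  = 7

code args : Formula → ℕ
code φ = ⟨ tag φ , args φ ⟩
args (t ≐ u) = ⟨ codeᵗ t , codeᵗ u ⟩
args (t ≼ u) = ⟨ codeᵗ t , codeᵗ u ⟩
args falsum  = 0
args (φ ∧ ψ) = ⟨ code φ , code ψ ⟩
args (φ ∨ ψ) = ⟨ code φ , code ψ ⟩
args (φ ⇒ ψ) = ⟨ code φ , code ψ ⟩
args (∀∙ φ)  = code φ
args (∃∙ φ)  = code φ

⌜_⌝ : Formula → Term
⌜ φ ⌝ = numeral (code φ)

private
  square-gap : ∀ {p q b d} → b ≤ p → p < q → p * p + b < q * q + d
  square-gap {p} {q} {b} {d} b≤p p<q = begin-strict
    p * p + b       ≤⟨ +-monoʳ-≤ (p * p) b≤p ⟩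
    p * p + p       ≡⟨ +-comm (p * p) p ⟩
    suc p * p       <⟨ *-monoʳ-< (suc p) (n<1+n p) ⟩
    suc p * suc p   ≤⟨ *-mono-≤ p<q p<q ⟩
    q * q           ≤⟨ m≤m+n (q * q) d ⟩
    q * q + d       ∎
    where open ≤-Reasoning

⟨,⟩-injective : ∀ {a b c d} → ⟨ a , b ⟩ ≡ ⟨ c , d ⟩ → a ≡ c × b ≡ d
⟨,⟩-injective {a} {b} {c} {d} e with <-cmp (a + b) (c + d)
... | tri< lt _ _ = contradiction e (<⇒≢ (square-gap (m≤n+m b a) lt))
... | tri> _ _ gt = contradiction (sym e) (<⇒≢ (square-gap (m≤n+m d c) gt))
... | tri≈ _ p≡q _ = +-cancelʳ-≡ d a c (trans (cong (a +_) (sym b≡d)) p≡q) , b≡d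
  where
  b≡d : b ≡ d
  b≡d = +-cancelˡ-≡ ((c + d) * (c + d)) b d
          (trans (cong (λ p → p * p + b) (sym p≡q)) e)

mutual
  codeᵗ-injective : ∀ t u → codeᵗ t ≡ codeᵗ u → t ≡ u
  codeᵗ-injective t u e with p , q ← ⟨,⟩-injective e with r , s ← ⟨,⟩-injective q =
    partsᵗ t u p r s

  private
    partsᵗ : ∀ t u → succs t ≡ succs u → tagᵗ t ≡ tagᵗ u → argsᵗ t ≡ argsᵗ u → t ≡ u
    partsᵗ (var _)  (var _)  _ _ e = cong var e
    partsᵗ 𝟎        𝟎        _ _ _ = refl
    partsᵗ (𝗌 t)    (𝗌 u)    p q e = cong 𝗌 (partsᵗ t u (suc-injective p) q e)
    partsᵗ (t ⊕ t′) (u ⊕ u′) _ _ e with p , q ← ⟨,⟩-injective e =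
      cong₂ _⊕_ (codeᵗ-injective t u p) (codeᵗ-injective t′ u′ q)
    partsᵗ (t ⊗ t′) (u ⊗ u′) _ _ e with p , q ← ⟨,⟩-injective e =
      cong₂ _⊗_ (codeᵗ-injective t u p) (codeᵗ-injective t′ u′ q)

mutual
  code-injective : ∀ φ ψ → code φ ≡ code ψ → φ ≡ ψ
  code-injective φ ψ e with p , q ← ⟨,⟩-injective e = parts φ ψ p q

  private
    parts : ∀ φ ψ → tag φ ≡ tag ψ → args φ ≡ args ψ → φ ≡ ψ
    parts (t ≐ t′) (u ≐ u′) _ e with p , q ← ⟨,⟩-injective e =
      cong₂ _≐_ (codeᵗ-injective t u p) (codeᵗ-injective t′ u′ q)
    parts (t ≼ t′) (u ≼ u′) _ e with p , q ← ⟨,⟩-injective e =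
      cong₂ _≼_ (codeᵗ-injective t u p) (codeᵗ-injective t′ u′ q)
    parts falsum   falsum   _ _ = refl
    parts (φ ∧ φ′) (ψ ∧ ψ′) _ e with p , q ← ⟨,⟩-injective e =
      cong₂ _∧_ (code-injective φ ψ p) (code-injective φ′ ψ′ q)
    parts (φ ∨ φ′) (ψ ∨ ψ′) _ e with p , q ← ⟨,⟩-injective e =
      cong₂ _∨_ (code-injective φ ψ p) (code-injective φ′ ψ′ q)
    parts (φ ⇒ φ′) (ψ ⇒ ψ′) _ e with p , q ← ⟨,⟩-injective e =
      cong₂ _⇒_ (code-injective φ ψ p) (code-injective φ′ ψ′ q)
    parts (∀∙ φ)   (∀∙ ψ)   _ e = cong ∀∙_ (code-injective φ ψ e)
    parts (∃∙ φ)   (∃∙ ψ)   _ e = cong ∃∙_ (code-injective φ ψ e)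

data Rec : ℕ → Set where
  Z    : Rec 0
  Sc   : Rec 1
  π    : ∀ {n} → Fin n → Rec n
  comp : ∀ {m n} → Rec m → Vec (Rec n) m → Rec n
  prec : ∀ {n} → Rec n → Rec (suc (suc n)) → Rec (suc n)
  μ    : ∀ {n} → Rec (suc n) → Rec n

infix 0 _·_⇓_ _·_⇓*_

mutual
  data _·_⇓_ : ∀ {n} → Rec n → Vec ℕ n → ℕ → Set where
    Z⇓     : Z · [] ⇓ 0
    Sc⇓    : ∀ {x} → Sc · x ∷ [] ⇓ suc x
    π⇓     : ∀ {n} {i : Fin n} {xs} → π i · xs ⇓ lookup xs i
    comp⇓  : ∀ {m n} {f : Rec m} {gs : Vec (Rec n) m} {xs ys z} →
             gs · xs ⇓* ys → f · ys ⇓ z → comp f gs · xs ⇓ z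
    prec0⇓ : ∀ {n} {f : Rec n} {g xs y} →
             f · xs ⇓ y → prec f g · 0 ∷ xs ⇓ y
    precs⇓ : ∀ {n} {f : Rec n} {g k xs y z} →
             prec f g · k ∷ xs ⇓ y → g · k ∷ y ∷ xs ⇓ z → prec f g · suc k ∷ xs ⇓ z
    μ⇓     : ∀ {n} {f : Rec (suc n)} {xs y} →
             (∀ z → z < y → ∃ λ v → f · z ∷ xs ⇓ suc v) →
             f · y ∷ xs ⇓ 0 → μ f · xs ⇓ y

  data _·_⇓*_ {n} : ∀ {m} → Vec (Rec n) m → Vec ℕ n → Vec ℕ m → Set where
    []  : ∀ {xs} → [] · xs ⇓* []
    _∷_ : ∀ {m} {g : Rec n} {gs : Vec (Rec n) m} {xs y ys} →
          g · xs ⇓ y → gs · xs ⇓* ys → g ∷ gs · xs ⇓* y ∷ ys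

-- A set of numbers is c.e. if it is the domain of a partial recursive function.
CESet : (ℕ → Set) → Set
CESet A = ∃ λ (f : Rec 1) → ∀ x → A x ⇔ ∃ λ y → f · x ∷ [] ⇓ y

CE : Theory → Set
CE T = CESet λ x → ∃ λ φ → Axiom T φ × code φ ≡ x

IsProvabilityPredicate : Theory → Theory → Formula → Set
IsProvabilityPredicate S T Pr =
  Below 1 Pr × (∀ φ → (T ⊢ φ) ⇔ (S ⊢ Pr [ ⌜ φ ⌝ ]))

iterate : Formula → ℕ → Formula → Formula
iterate Pr zero    φ = φ
iterate Pr (suc i) φ = Pr [ ⌜ iterate Pr i φ ⌝ ]

C : Theory → Formula → Set
C S Pr = ∀ φ ψ → S ⊢ Pr [ ⌜ φ ⌝ ] ∧ Pr [ ⌜ ψ ⌝ ] ⇒ Pr [ ⌜ φ ∧ ψ ⌝ ]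

D3 : Theory → Formula → ℕ → ℕ → Set
D3 S Pr n m = ∀ φ → S ⊢ iterate Pr n φ ⇒ iterate Pr m φ

Ros : Theory → Formula → Set
Ros T Pr = ∀ φ → T ⊢ ¬∙ φ → T ⊢ ¬∙ Pr [ ⌜ φ ⌝ ]

{-# OPTIONS --safe #-}

-- The condition D3ⁿₙ₊ₖ iterates to D3ⁿₙ₊ⱼₖ for every j, so k may be replaced by
-- K = nk ≥ n.  Take σ with PA ⊢ σ ↔ ¬Pr^K(σ).  Then σ ∧ Pr^K(σ) is refutable in
-- T, and alternating Ros and C gives T ⊢ ¬(Pr^i(σ) ∧ Pr^(i+K)(σ)) for every i.
-- For i = n, D3 yields T ⊢ ¬Pr^n(σ); since K ≥ n, Ros yields T ⊢ ¬Pr^K(σ), that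
-- is T ⊢ σ, whence T ⊢ Pr^K(σ), a contradiction.
--
-- The code of a numeral is a polynomial in its value, hence so is the code of
-- φ(n̄) for fixed φ.  The fixed point therefore needs no representability
-- beyond the evaluation of closed terms in PA.

module Submission where

open import Defs
open import Data.List using (List; _∷_)
open import Data.List.Relation.Unary.Any using (here; there)
open import Data.Maybe using (Maybe; just; nothing; maybe)
import Data.Maybe as Maybe
open import Data.Nat using (ℕ; zero; suc; _+_; _*_; _∸_; _≤_; _<_; s≤s; z≤n)
open import Data.Nat.Properties
  using (+-suc; +-identityʳ; +-assoc; +-comm; *-suc; *-zeroʳ; m≤m*n; m∸n+n≡m)
open import Data.Product as Product using (∃; _,_; proj₁; proj₂)
open import Data.Unit using (tt)
open import Function.Bundles using (module Equivalence)
open import Relation.Binary.PropositionalEquality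
  using (_≡_; refl; sym; trans; cong; cong₂; subst; subst₂; module ≡-Reasoning)
open import Relation.Nullary using (¬_)

-- Substitution

instantiate-↑ᵗ : ∀ u t → subᵗ (instantiate u) (↑ᵗ t) ≡ t
instantiate-↑ᵗ u (var i) = refl
instantiate-↑ᵗ u 𝟎       = refl
instantiate-↑ᵗ u (𝗌 t)   = cong 𝗌 (instantiate-↑ᵗ u t)
instantiate-↑ᵗ u (t ⊕ v) = cong₂ _⊕_ (instantiate-↑ᵗ u t) (instantiate-↑ᵗ u v)
instantiate-↑ᵗ u (t ⊗ v) = cong₂ _⊗_ (instantiate-↑ᵗ u t) (instantiate-↑ᵗ u v)

subᵗ-numeral : ∀ ρ n → subᵗ ρ (numeral n) ≡ numeral n
subᵗ-numeral ρ zero    = refl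
subᵗ-numeral ρ (suc n) = cong 𝗌 (subᵗ-numeral ρ n)

subᵗ-const : ∀ ρ u t → subᵗ ρ (subᵗ (λ _ → u) t) ≡ subᵗ (λ _ → subᵗ ρ u) t
subᵗ-const ρ u (var i) = refl
subᵗ-const ρ u 𝟎       = refl
subᵗ-const ρ u (𝗌 t)   = cong 𝗌 (subᵗ-const ρ u t)
subᵗ-const ρ u (t ⊕ v) = cong₂ _⊕_ (subᵗ-const ρ u t) (subᵗ-const ρ u v)
subᵗ-const ρ u (t ⊗ v) = cong₂ _⊗_ (subᵗ-const ρ u t) (subᵗ-const ρ u v)

Belowᵗ-numeral : ∀ k n → Belowᵗ k (numeral n)
Belowᵗ-numeral k zero    = tt
Belowᵗ-numeral k (suc n) = Belowᵗ-numeral k n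

Belowᵗ-sub : ∀ {k l ρ} → (∀ i → i < k → Belowᵗ l (ρ i)) → ∀ t → Belowᵗ k t → Belowᵗ l (subᵗ ρ t)
Belowᵗ-sub h (var i) b       = h i b
Belowᵗ-sub h 𝟎       b       = tt
Belowᵗ-sub h (𝗌 t)   b       = Belowᵗ-sub h t b
Belowᵗ-sub h (t ⊕ u) (b , c) = Belowᵗ-sub h t b , Belowᵗ-sub h u c
Belowᵗ-sub h (t ⊗ u) (b , c) = Belowᵗ-sub h t b , Belowᵗ-sub h u c

Belowᵗ-lift : ∀ {k l ρ} → (∀ i → i < k → Belowᵗ l (ρ i)) → ∀ i → i < suc k → Belowᵗ (suc l) (lift ρ i)
Belowᵗ-lift         h zero    _       = s≤s z≤n
Belowᵗ-lift {ρ = ρ} h (suc i) (s≤s p) = Belowᵗ-sub (λ _ → s≤s) (ρ i) (h i p)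

Below-sub : ∀ {k l ρ} → (∀ i → i < k → Belowᵗ l (ρ i)) → ∀ φ → Below k φ → Below l (sub ρ φ)
Below-sub h (t ≐ u) (b , c) = Belowᵗ-sub h t b , Belowᵗ-sub h u c
Below-sub h (t ≼ u) (b , c) = Belowᵗ-sub h t b , Belowᵗ-sub h u c
Below-sub h falsum  b       = tt
Below-sub h (φ ∧ ψ) (b , c) = Below-sub h φ b , Below-sub h ψ c
Below-sub h (φ ∨ ψ) (b , c) = Below-sub h φ b , Below-sub h ψ c
Below-sub h (φ ⇒ ψ) (b , c) = Below-sub h φ b , Below-sub h ψ c
Below-sub h (∀∙ φ)  b       = Below-sub (Belowᵗ-lift h) φ b
Below-sub h (∃∙ φ)  b       = Below-sub (Belowᵗ-lift h) φ b

subᵗ-fix : ∀ {k ρ} → (∀ i → i < k → ρ i ≡ var i) → ∀ t → Belowᵗ k t → subᵗ ρ t ≡ t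
subᵗ-fix h (var i) b       = h i b
subᵗ-fix h 𝟎       b       = refl
subᵗ-fix h (𝗌 t)   b       = cong 𝗌 (subᵗ-fix h t b)
subᵗ-fix h (t ⊕ u) (b , c) = cong₂ _⊕_ (subᵗ-fix h t b) (subᵗ-fix h u c)
subᵗ-fix h (t ⊗ u) (b , c) = cong₂ _⊗_ (subᵗ-fix h t b) (subᵗ-fix h u c)

lift-fix : ∀ {k ρ} → (∀ i → i < k → ρ i ≡ var i) → ∀ i → i < suc k → lift ρ i ≡ var i
lift-fix h zero    _       = refl
lift-fix h (suc i) (s≤s p) = cong ↑ᵗ (h i p)

-- Serves at `k = 0` for shifting a sentence, and at `k = 1` for instantiating variable 0 by itself
-- and for lifted substitutions.
sub-fix : ∀ {k ρ} → (∀ i → i < k → ρ i ≡ var i) → ∀ φ → Below k φ → sub ρ φ ≡ φ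
sub-fix h (t ≐ u) (b , c) = cong₂ _≐_ (subᵗ-fix h t b) (subᵗ-fix h u c)
sub-fix h (t ≼ u) (b , c) = cong₂ _≼_ (subᵗ-fix h t b) (subᵗ-fix h u c)
sub-fix h falsum  b       = refl
sub-fix h (φ ∧ ψ) (b , c) = cong₂ _∧_ (sub-fix h φ b) (sub-fix h ψ c)
sub-fix h (φ ∨ ψ) (b , c) = cong₂ _∨_ (sub-fix h φ b) (sub-fix h ψ c)
sub-fix h (φ ⇒ ψ) (b , c) = cong₂ _⇒_ (sub-fix h φ b) (sub-fix h ψ c)
sub-fix h (∀∙ φ)  b       = cong ∀∙_ (sub-fix (lift-fix h) φ b)
sub-fix h (∃∙ φ)  b       = cong ∃∙_ (sub-fix (lift-fix h) φ b)

↑-sentence : ∀ φ → Sentence φ → ↑ φ ≡ φ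
↑-sentence = sub-fix (λ _ ())

instantiate-var0 : ∀ φ → Below 1 φ → φ [ var 0 ] ≡ φ
instantiate-var0 = sub-fix λ { zero _ → refl ; (suc _) (s≤s ()) }

sub-lift-fix : ∀ ρ φ → Below 1 φ → sub (lift ρ) φ ≡ φ
sub-lift-fix ρ = sub-fix (lift-fix {ρ = ρ} (λ _ ()))

instantiate-numeral-sentence : ∀ n φ → Below 1 φ → Sentence (φ [ numeral n ])
instantiate-numeral-sentence n =
  Below-sub λ { zero _ → Belowᵗ-numeral 0 n ; (suc _) (s≤s ()) }

-- Equality and the evaluation of closed terms in PA

module _ {T : Theory} {Γ : List Formula} where

  -- `≐E` rewrites variable 0 throughout a formula. The side that must stay put is shifted by `↑ᵗ`,
  -- and instantiation undoes the shift. The next lemmas use the same device.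
  ≐-sym : ∀ {t u} → T ∣ Γ ⊢ t ≐ u → T ∣ Γ ⊢ u ≐ t
  ≐-sym {t} {u} p =
    subst (λ v → T ∣ Γ ⊢ u ≐ v) (instantiate-↑ᵗ u t)
      (≐E (var 0 ≐ ↑ᵗ t) p (subst (λ v → T ∣ Γ ⊢ t ≐ v) (sym (instantiate-↑ᵗ t t)) (≐I t)))

  ≐-trans : ∀ {t u v} → T ∣ Γ ⊢ t ≐ u → T ∣ Γ ⊢ u ≐ v → T ∣ Γ ⊢ t ≐ v
  ≐-trans {t} {u} {v} p q =
    subst (λ w → T ∣ Γ ⊢ w ≐ v) (instantiate-↑ᵗ v t)
      (≐E (↑ᵗ t ≐ var 0) q (subst (λ w → T ∣ Γ ⊢ w ≐ u) (sym (instantiate-↑ᵗ u t)) p))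

  ≐-cong : ∀ f {t u} → T ∣ Γ ⊢ t ≐ u → T ∣ Γ ⊢ subᵗ (instantiate t) f ≐ subᵗ (instantiate u) f
  ≐-cong f {t} {u} p =
    subst (λ w → T ∣ Γ ⊢ w ≐ subᵗ (instantiate u) f) (instantiate-↑ᵗ u f[t])
      (≐E (↑ᵗ f[t] ≐ f) p
        (subst (λ w → T ∣ Γ ⊢ w ≐ f[t]) (sym (instantiate-↑ᵗ t f[t])) (≐I f[t])))
    where f[t] = subᵗ (instantiate t) f

  ⊕-cong : ∀ {t t′ u u′} → T ∣ Γ ⊢ t ≐ t′ → T ∣ Γ ⊢ u ≐ u′ → T ∣ Γ ⊢ t ⊕ u ≐ t′ ⊕ u′
  ⊕-cong {t} {t′} {u} {u′} p q = ≐-trans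
    (subst₂ (λ v w → T ∣ Γ ⊢ t ⊕ v ≐ t′ ⊕ w) (instantiate-↑ᵗ t u) (instantiate-↑ᵗ t′ u)
      (≐-cong (var 0 ⊕ ↑ᵗ u) p))
    (subst₂ (λ v w → T ∣ Γ ⊢ v ⊕ u ≐ w ⊕ u′) (instantiate-↑ᵗ u t′) (instantiate-↑ᵗ u′ t′)
      (≐-cong (↑ᵗ t′ ⊕ var 0) q))

  ⊗-cong : ∀ {t t′ u u′} → T ∣ Γ ⊢ t ≐ t′ → T ∣ Γ ⊢ u ≐ u′ → T ∣ Γ ⊢ t ⊗ u ≐ t′ ⊗ u′
  ⊗-cong {t} {t′} {u} {u′} p q = ≐-trans
    (subst₂ (λ v w → T ∣ Γ ⊢ t ⊗ v ≐ t′ ⊗ w) (instantiate-↑ᵗ t u) (instantiate-↑ᵗ t′ u)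
      (≐-cong (var 0 ⊗ ↑ᵗ u) p))
    (subst₂ (λ v w → T ∣ Γ ⊢ v ⊗ u ≐ w ⊗ u′) (instantiate-↑ᵗ u t′) (instantiate-↑ᵗ u′ t′)
      (≐-cong (↑ᵗ t′ ⊗ var 0) q))

module _ {Γ : List Formula} where

  PA-+s : ∀ t u → PA ∣ Γ ⊢ t ⊕ 𝗌 u ≐ 𝗌 (t ⊕ u)
  PA-+s t u = subst (λ v → PA ∣ Γ ⊢ v ⊕ 𝗌 u ≐ 𝗌 (v ⊕ u)) (instantiate-↑ᵗ u t)
    (∀E u (∀E t (ax +s)))

  PA-×s : ∀ t u → PA ∣ Γ ⊢ t ⊗ 𝗌 u ≐ t ⊗ u ⊕ t
  PA-×s t u = subst (λ v → PA ∣ Γ ⊢ v ⊗ 𝗌 u ≐ v ⊗ u ⊕ v) (instantiate-↑ᵗ u t)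
    (∀E u (∀E t (ax ×s)))

  PA-numeral-+ : ∀ a b → PA ∣ Γ ⊢ numeral a ⊕ numeral b ≐ numeral (a + b)
  PA-numeral-+ a zero rewrite +-identityʳ a = ∀E (numeral a) (ax +0)
  PA-numeral-+ a (suc b) rewrite +-suc a b =
    ≐-trans (PA-+s (numeral a) (numeral b)) (≐-cong (𝗌 (var 0)) (PA-numeral-+ a b))

  PA-numeral-* : ∀ a b → PA ∣ Γ ⊢ numeral a ⊗ numeral b ≐ numeral (a * b)
  PA-numeral-* a zero rewrite *-zeroʳ a = ∀E (numeral a) (ax ×0)
  PA-numeral-* a (suc b) rewrite *-suc a b | +-comm a (a * b) =
    ≐-trans (PA-×s (numeral a) (numeral b))
      (≐-trans (⊕-cong (PA-numeral-* a b) (≐I (numeral a))) (PA-numeral-+ (a * b) a))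

-- Terms serve as polynomials in one unknown, which every variable denotes.
eval : ℕ → Term → ℕ
eval m (var _) = m
eval m 𝟎       = 0
eval m (𝗌 t)   = suc (eval m t)
eval m (t ⊕ u) = eval m t + eval m u
eval m (t ⊗ u) = eval m t * eval m u

eval-numeral : ∀ m n → eval m (numeral n) ≡ n
eval-numeral m zero    = refl
eval-numeral m (suc n) = cong suc (eval-numeral m n)

eval-const : ∀ m u t → eval m (subᵗ (λ _ → u) t) ≡ eval (eval m u) t
eval-const m u (var i) = refl
eval-const m u 𝟎       = refl
eval-const m u (𝗌 t)   = cong suc (eval-const m u t)
eval-const m u (t ⊕ v) = cong₂ _+_ (eval-const m u t) (eval-const m u v)
eval-const m u (t ⊗ v) = cong₂ _*_ (eval-const m u t) (eval-const m u v)

-- The unknown is any term `u` provably equal to a numeral in context `Γ`: below it is once an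
-- eigenvariable assumed equal to `numeral m`, once that numeral itself.
PA-eval : ∀ {Γ u m} → PA ∣ Γ ⊢ u ≐ numeral m →
          ∀ t → PA ∣ Γ ⊢ subᵗ (λ _ → u) t ≐ numeral (eval m t)
PA-eval p (var i) = p
PA-eval p 𝟎       = ≐I 𝟎
PA-eval p (𝗌 t)   = ≐-cong (𝗌 (var 0)) (PA-eval p t)
PA-eval {m = m} p (t ⊕ v) =
  ≐-trans (⊕-cong (PA-eval p t) (PA-eval p v)) (PA-numeral-+ (eval m t) (eval m v))
PA-eval {m = m} p (t ⊗ v) =
  ≐-trans (⊗-cong (PA-eval p t) (PA-eval p v)) (PA-numeral-* (eval m t) (eval m v))

-- Codes as polynomials

-- Repeats the formula of `⟨_,_⟩`, so `eval` commutes with pairing by computation and the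
-- correctness proofs reduce to `cong₂`.
pairᵗ : Term → Term → Term
pairᵗ t u = (t ⊕ u) ⊗ (t ⊕ u) ⊕ u

-- In a substitution schema, nothing stands for the numeral of the unknown.
Schema : Set
Schema = ℕ → Maybe ℕ

at : ℕ → Schema → ℕ → Term
at n s i = maybe var (numeral n) (s i)

instantiateₛ : Schema
instantiateₛ zero    = nothing
instantiateₛ (suc i) = just i

liftₛ : Schema → Schema
liftₛ s zero    = just 0
liftₛ s (suc i) = Maybe.map suc (s i)

-- Numerals are closed, so the shift under a binder leaves the unknown in place.
lift-at : ∀ {n s ρ} → (∀ i → ρ i ≡ at n s i) → ∀ i → lift ρ i ≡ at n (liftₛ s) i
lift-at h zero = refl
lift-at {n} {s} h (suc i) rewrite h i with s i
... | just _  = refl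
... | nothing = subᵗ-numeral _ n

succs-numeral : ∀ n → succs (numeral n) ≡ n
succs-numeral zero    = refl
succs-numeral (suc n) = cong suc (succs-numeral n)

tagᵗ-numeral : ∀ n → tagᵗ (numeral n) ≡ 1
tagᵗ-numeral zero    = refl
tagᵗ-numeral (suc n) = tagᵗ-numeral n

argsᵗ-numeral : ∀ n → argsᵗ (numeral n) ≡ 0
argsᵗ-numeral zero    = refl
argsᵗ-numeral (suc n) = argsᵗ-numeral n

codeᵗ-numeral : ∀ n → codeᵗ (numeral n) ≡ ⟨ n , ⟨ 1 , 0 ⟩ ⟩
codeᵗ-numeral n = cong₂ ⟨_,_⟩ (succs-numeral n) (cong₂ ⟨_,_⟩ (tagᵗ-numeral n) (argsᵗ-numeral n))

module _ (s : Schema) where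

  -- Since a code counts leading successors, a numeral put for a variable contributes its value to
  -- that count and otherwise looks like `𝟎`, with tag 1 and argument 0. This keeps the code
  -- polynomial in the unknown.
  succsₚ tagᵗₚ codeᵗₚ argsᵗₚ : Term → Term
  succsₚ (var i) = maybe (λ _ → 𝟎) (var 0) (s i)
  succsₚ (𝗌 t)   = 𝗌 (succsₚ t)
  succsₚ _       = 𝟎
  tagᵗₚ (var i) = maybe (λ _ → 𝟎) (numeral 1) (s i)
  tagᵗₚ (𝗌 t)   = tagᵗₚ t
  tagᵗₚ t       = numeral (tagᵗ t)
  codeᵗₚ t = pairᵗ (succsₚ t) (pairᵗ (tagᵗₚ t) (argsᵗₚ t))
  argsᵗₚ (var i) = maybe numeral 𝟎 (s i)
  argsᵗₚ 𝟎       = 𝟎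
  argsᵗₚ (𝗌 t)   = argsᵗₚ t
  argsᵗₚ (t ⊕ u) = pairᵗ (codeᵗₚ t) (codeᵗₚ u)
  argsᵗₚ (t ⊗ u) = pairᵗ (codeᵗₚ t) (codeᵗₚ u)

codeₚ argsₚ : Schema → Formula → Term
codeₚ s φ = pairᵗ (numeral (tag φ)) (argsₚ s φ)
argsₚ s (t ≐ u) = pairᵗ (codeᵗₚ s t) (codeᵗₚ s u)
argsₚ s (t ≼ u) = pairᵗ (codeᵗₚ s t) (codeᵗₚ s u)
argsₚ s falsum  = 𝟎
argsₚ s (φ ∧ ψ) = pairᵗ (codeₚ s φ) (codeₚ s ψ)
argsₚ s (φ ∨ ψ) = pairᵗ (codeₚ s φ) (codeₚ s ψ)
argsₚ s (φ ⇒ ψ) = pairᵗ (codeₚ s φ) (codeₚ s ψ)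
argsₚ s (∀∙ φ)  = codeₚ (liftₛ s) φ
argsₚ s (∃∙ φ)  = codeₚ (liftₛ s) φ

module _ {n : ℕ} {s : Schema} {ρ : ℕ → Term} (h : ∀ i → ρ i ≡ at n s i) where

  eval-succsₚ : ∀ t → eval n (succsₚ s t) ≡ succs (subᵗ ρ t)
  eval-succsₚ (var i) rewrite h i with s i
  ... | just _  = refl
  ... | nothing = sym (succs-numeral n)
  eval-succsₚ 𝟎       = refl
  eval-succsₚ (𝗌 t)   = cong suc (eval-succsₚ t)
  eval-succsₚ (t ⊕ u) = refl
  eval-succsₚ (t ⊗ u) = refl

  eval-tagᵗₚ : ∀ t → eval n (tagᵗₚ s t) ≡ tagᵗ (subᵗ ρ t)
  eval-tagᵗₚ (var i) rewrite h i with s i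
  ... | just _  = refl
  ... | nothing = sym (tagᵗ-numeral n)
  eval-tagᵗₚ 𝟎       = refl
  eval-tagᵗₚ (𝗌 t)   = eval-tagᵗₚ t
  eval-tagᵗₚ (t ⊕ u) = refl
  eval-tagᵗₚ (t ⊗ u) = refl

  eval-codeᵗₚ : ∀ t → eval n (codeᵗₚ s t) ≡ codeᵗ (subᵗ ρ t)
  eval-argsᵗₚ : ∀ t → eval n (argsᵗₚ s t) ≡ argsᵗ (subᵗ ρ t)
  eval-codeᵗₚ t = cong₂ ⟨_,_⟩ (eval-succsₚ t) (cong₂ ⟨_,_⟩ (eval-tagᵗₚ t) (eval-argsᵗₚ t))
  eval-argsᵗₚ (var i) rewrite h i with s i
  ... | just j  = eval-numeral n j
  ... | nothing = sym (argsᵗ-numeral n)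
  eval-argsᵗₚ 𝟎       = refl
  eval-argsᵗₚ (𝗌 t)   = eval-argsᵗₚ t
  eval-argsᵗₚ (t ⊕ u) = cong₂ ⟨_,_⟩ (eval-codeᵗₚ t) (eval-codeᵗₚ u)
  eval-argsᵗₚ (t ⊗ u) = cong₂ ⟨_,_⟩ (eval-codeᵗₚ t) (eval-codeᵗₚ u)

tag-sub : ∀ ρ φ → tag (sub ρ φ) ≡ tag φ
tag-sub ρ (t ≐ u) = refl
tag-sub ρ (t ≼ u) = refl
tag-sub ρ falsum  = refl
tag-sub ρ (φ ∧ ψ) = refl
tag-sub ρ (φ ∨ ψ) = refl
tag-sub ρ (φ ⇒ ψ) = refl
tag-sub ρ (∀∙ φ)  = refl
tag-sub ρ (∃∙ φ)  = refl

-- The substitution is described pointwise because under a binder `lift ρ` agrees with the lifted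
-- schema only pointwise.
eval-codeₚ : ∀ {n s ρ} → (∀ i → ρ i ≡ at n s i) → ∀ φ → eval n (codeₚ s φ) ≡ code (sub ρ φ)
eval-argsₚ : ∀ {n s ρ} → (∀ i → ρ i ≡ at n s i) → ∀ φ → eval n (argsₚ s φ) ≡ args (sub ρ φ)
eval-codeₚ {n} {ρ = ρ} h φ =
  cong₂ ⟨_,_⟩ (trans (eval-numeral n (tag φ)) (sym (tag-sub ρ φ))) (eval-argsₚ h φ)
eval-argsₚ h (t ≐ u) = cong₂ ⟨_,_⟩ (eval-codeᵗₚ h t) (eval-codeᵗₚ h u)
eval-argsₚ h (t ≼ u) = cong₂ ⟨_,_⟩ (eval-codeᵗₚ h t) (eval-codeᵗₚ h u)
eval-argsₚ h falsum  = refl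
eval-argsₚ h (φ ∧ ψ) = cong₂ ⟨_,_⟩ (eval-codeₚ h φ) (eval-codeₚ h ψ)
eval-argsₚ h (φ ∨ ψ) = cong₂ ⟨_,_⟩ (eval-codeₚ h φ) (eval-codeₚ h ψ)
eval-argsₚ h (φ ⇒ ψ) = cong₂ ⟨_,_⟩ (eval-codeₚ h φ) (eval-codeₚ h ψ)
eval-argsₚ h (∀∙ φ)  = eval-codeₚ (lift-at h) φ
eval-argsₚ h (∃∙ φ)  = eval-codeₚ (lift-at h) φ

eval-code-instantiate : ∀ n φ → eval n (codeₚ instantiateₛ φ) ≡ code (φ [ numeral n ])
eval-code-instantiate n = eval-codeₚ λ { zero → refl ; (suc _) → refl }

-- The `i`-fold composition of the polynomial sending `m` to the code of `Pr [ numeral m ]`.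
iterateₚ : Formula → ℕ → Term
iterateₚ Pr zero    = var 0
iterateₚ Pr (suc i) = subᵗ (λ _ → iterateₚ Pr i) (codeₚ instantiateₛ Pr)

eval-iterateₚ : ∀ Pr i φ → eval (code φ) (iterateₚ Pr i) ≡ code (iterate Pr i φ)
eval-iterateₚ Pr zero    φ = refl
eval-iterateₚ Pr (suc i) φ = begin
  eval (code φ) (iterateₚ Pr (suc i))
    ≡⟨ eval-const (code φ) (iterateₚ Pr i) (codeₚ instantiateₛ Pr) ⟩
  eval (eval (code φ) (iterateₚ Pr i)) (codeₚ instantiateₛ Pr)
    ≡⟨ cong (λ m → eval m (codeₚ instantiateₛ Pr)) (eval-iterateₚ Pr i φ) ⟩
  eval (code (iterate Pr i φ)) (codeₚ instantiateₛ Pr)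
    ≡⟨ eval-code-instantiate (code (iterate Pr i φ)) Pr ⟩
  code (iterate Pr (suc i) φ) ∎
  where open ≡-Reasoning

-- Fixed points

-- "φ holds at m", without substituting into φ, so that its code is a
-- polynomial in m and the code of φ.
holdsAt : ℕ → Formula → Formula
holdsAt m φ = ∃∙ (var 0 ≐ numeral m ∧ φ)

∃ₚ : Term → Term
∃ₚ t = pairᵗ (numeral 7) t

_∧ₚ_ _≐ₚ_ : Term → Term → Term
t ∧ₚ u = pairᵗ (numeral 3) (pairᵗ t u)
t ≐ₚ u = pairᵗ 𝟎 (pairᵗ t u)

eval-∃ₚ : ∀ {m t φ} → eval m t ≡ code φ → eval m (∃ₚ t) ≡ code (∃∙ φ)
eval-∃ₚ = cong ⟨ 7 ,_⟩

eval-∧ₚ : ∀ {m t u φ ψ} → eval m t ≡ code φ → eval m u ≡ code ψ → eval m (t ∧ₚ u) ≡ code (φ ∧ ψ)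
eval-∧ₚ = cong₂ (λ a b → ⟨ 3 , ⟨ a , b ⟩ ⟩)

eval-≐ₚ : ∀ {m t u v w} → eval m t ≡ codeᵗ v → eval m u ≡ codeᵗ w → eval m (t ≐ₚ u) ≡ code (v ≐ w)
eval-≐ₚ = cong₂ (λ a b → ⟨ 0 , ⟨ a , b ⟩ ⟩)

numeralₚ : Term
numeralₚ = pairᵗ (var 0) (pairᵗ (numeral 1) 𝟎)

eval-numeralₚ : ∀ m → eval m numeralₚ ≡ codeᵗ (numeral m)
eval-numeralₚ m = sym (codeᵗ-numeral m)

-- The diagonal function: it sends the code `m` of `φ` to the code of `holdsAt m φ`. The first `𝟎`
-- is the code of `var 0`, which computes to 0.
diagonalₚ : Term
diagonalₚ = ∃ₚ ((𝟎 ≐ₚ numeralₚ) ∧ₚ var 0)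

eval-diagonalₚ : ∀ {m} φ → code φ ≡ m → eval m diagonalₚ ≡ code (holdsAt m φ)
eval-diagonalₚ {m} φ refl =
  eval-∃ₚ {m} {(𝟎 ≐ₚ numeralₚ) ∧ₚ var 0} {var 0 ≐ numeral m ∧ φ}
    (eval-∧ₚ {m} {𝟎 ≐ₚ numeralₚ} {var 0} {var 0 ≐ numeral m} {φ}
      (eval-≐ₚ {m} {𝟎} {numeralₚ} {var 0} {numeral m} refl (eval-numeralₚ m)) refl)

-- Expresses A(t(x)), where x is the free variable 0, seen as `var 1` under the quantifier. The
-- quantifier deliberately binds variable 0 of `A`.
holdsAtValue : Formula → Term → Formula
holdsAtValue A t = ∃∙ (var 0 ≐ subᵗ (λ _ → var 1) t ∧ A)

PA-holdsAtValue : ∀ A t m → Below 1 A →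
  PA ⊢ holdsAt m (holdsAtValue A t) ⇔∙ A [ numeral (eval m t) ]
PA-holdsAtValue A t m A₁ = ∧I (⇒I to) (⇒I (from (hyp (here refl))))
  where
  c = numeral (eval m t)

  ↑A[c] : ↑ (A [ c ]) ≡ A [ c ]
  ↑A[c] = ↑-sentence (A [ c ]) (instantiate-numeral-sentence (eval m t) A A₁)

  -- Two existentials are eliminated, hence two shifts: `var 1` is the outer witness, equal to m,
  -- and `var 0` the inner one, equal to t(m).
  transfer : ∀ {Γ} → PA ∣ Γ ⊢ var 1 ≐ ↑ᵗ (numeral m) →
    PA ∣ Γ ⊢ var 0 ≐ subᵗ (λ _ → var 1) t ∧ A → PA ∣ Γ ⊢ ↑ (↑ (A [ c ]))
  transfer {Γ} p q = subst (PA ∣ Γ ⊢_) (sym (trans (cong ↑ ↑A[c]) ↑A[c]))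
    (≐E A (≐-trans (∧E₁ q) (PA-eval x≐m t))
      (subst (PA ∣ Γ ⊢_) (sym (instantiate-var0 A A₁)) (∧E₂ q)))
    where
    x≐m : PA ∣ Γ ⊢ var 1 ≐ numeral m
    x≐m = subst (λ u → PA ∣ Γ ⊢ var 1 ≐ u) (subᵗ-numeral (λ i → var (suc i)) m) p

  to : ∀ {Γ} → PA ∣ holdsAt m (holdsAtValue A t) ∷ Γ ⊢ A [ c ]
  to = ∃E (hyp (here refl)) (∃E (∧E₂ (hyp (here refl)))
    (transfer (∧E₁ (hyp (there (here refl)))) (hyp (here refl))))

  from : ∀ {Γ} → PA ∣ Γ ⊢ A [ c ] → PA ∣ Γ ⊢ holdsAt m (holdsAtValue A t)
  from {Γ} p = ∃I (numeral m) (∧I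
    (subst (λ u → PA ∣ Γ ⊢ numeral m ≐ u) (sym (subᵗ-numeral (instantiate (numeral m)) m))
      (≐I (numeral m)))
    (∃I c (∧I
      (subst (λ u → PA ∣ Γ ⊢ c ≐ u) (sym value) (≐-sym (PA-eval (≐I (numeral m)) t)))
      (subst (λ φ → PA ∣ Γ ⊢ φ [ c ]) (sym (sub-lift-fix (instantiate (numeral m)) A A₁)) p))))
    where
    value : subᵗ (instantiate c) (subᵗ (lift (instantiate (numeral m))) (subᵗ (λ _ → var 1) t))
            ≡ subᵗ (λ _ → numeral m) t
    value = begin
      subᵗ (instantiate c) (subᵗ (lift (instantiate (numeral m))) (subᵗ (λ _ → var 1) t))
        ≡⟨ cong (subᵗ (instantiate c)) (subᵗ-const _ (var 1) t) ⟩
      subᵗ (instantiate c) (subᵗ (λ _ → ↑ᵗ (numeral m)) t)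
        ≡⟨ subᵗ-const _ (↑ᵗ (numeral m)) t ⟩
      subᵗ (λ _ → subᵗ (instantiate c) (↑ᵗ (numeral m))) t
        ≡⟨ cong (λ u → subᵗ (λ _ → u) t) (instantiate-↑ᵗ c (numeral m)) ⟩
      subᵗ (λ _ → numeral m) t ∎
      where open ≡-Reasoning

-- The code m of θ is kept behind an equation, since type checking would otherwise
-- unfold it in unary.
PA-diagonal-at : ∀ A t θ m → Below 1 A →
  θ ≡ holdsAtValue A (subᵗ (λ _ → diagonalₚ) t) → code θ ≡ m →
  ∃ λ σ → PA ⊢ σ ⇔∙ A [ numeral (eval (code σ) t) ]
PA-diagonal-at A t θ m A₁ θ-def m-def = σ ,
  subst (λ v → PA ⊢ σ ⇔∙ A [ numeral v ]) value
    (subst (λ φ → PA ⊢ holdsAt m φ ⇔∙ A [ numeral (eval m t∘d) ]) (sym θ-def)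
      (PA-holdsAtValue A t∘d m A₁))
  where
  t∘d = subᵗ (λ _ → diagonalₚ) t
  -- θ(x) says A(t(d(x))) with d the diagonal function, and σ is θ at its own code m. As d(m) is the
  -- code of σ, σ says A(t(code σ)).
  σ = holdsAt m θ
  value : eval m t∘d ≡ eval (code σ) t
  value = trans (eval-const m diagonalₚ t) (cong (λ v → eval v t) (eval-diagonalₚ {m} θ m-def))

PA-diagonal : ∀ A t → Below 1 A → ∃ λ σ → PA ⊢ σ ⇔∙ A [ numeral (eval (code σ) t) ]
PA-diagonal A t A₁ = PA-diagonal-at A t θ (code θ) A₁ refl refl
  where θ = holdsAtValue A (subᵗ (λ _ → diagonalₚ) t)

-- The outermost `Pr` comes from the formula `¬∙ Pr` being diagonalized, the inner `i` from the
-- polynomial; hence the exponent `suc i`.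
PA-liar : ∀ Pr → Below 1 Pr → ∀ i → ∃ λ σ → PA ⊢ σ ⇔∙ ¬∙ iterate Pr (suc i) σ
PA-liar Pr Pr₁ i =
  Product.map₂ (λ {σ} → subst (λ v → PA ⊢ σ ⇔∙ (¬∙ Pr) [ numeral v ]) (eval-iterateₚ Pr i σ))
    (PA-diagonal (¬∙ Pr) (iterateₚ Pr i) (Pr₁ , tt))

-- Rosser predicates

iterate-+ : ∀ Pr i j φ → iterate Pr i (iterate Pr j φ) ≡ iterate Pr (i + j) φ
iterate-+ Pr zero    j φ = refl
iterate-+ Pr (suc i) j φ = cong (λ ψ → Pr [ ⌜ ψ ⌝ ]) (iterate-+ Pr i j φ)

-- Stated as closed tautologies so that theorems of a theory can be combined
-- by ⇒E alone, without weakening.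
module _ {T : Theory} where

  ⇒-compose : ∀ φ ψ χ → T ⊢ (φ ⇒ ψ) ⇒ (ψ ⇒ χ) ⇒ φ ⇒ χ
  ⇒-compose φ ψ χ = ⇒I (⇒I (⇒I (⇒E (hyp (there (here refl)))
    (⇒E (hyp (there (there (here refl)))) (hyp (here refl))))))

  ⇒-trans : ∀ {φ ψ χ} → T ⊢ φ ⇒ ψ → T ⊢ ψ ⇒ χ → T ⊢ φ ⇒ χ
  ⇒-trans p q = ⇒E (⇒E (⇒-compose _ _ _) p) q

  ⇒-diagonal : ∀ φ ψ → T ⊢ (φ ⇒ ψ) ⇒ φ ⇒ φ ∧ ψ
  ⇒-diagonal φ ψ = ⇒I (⇒I (∧I (hyp (here refl)) (⇒E (hyp (there (here refl))) (hyp (here refl)))))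

  ⇒-uncurry : ∀ φ ψ χ → T ⊢ (φ ⇒ ψ ⇒ χ) ⇒ φ ∧ ψ ⇒ χ
  ⇒-uncurry φ ψ χ = ⇒I (⇒I (⇒E (⇒E (hyp (there (here refl)))
    (∧E₁ (hyp (here refl)))) (∧E₂ (hyp (here refl)))))

-- Pr^(n+k)(φ) is Pr^n(Pr^k(φ)), so the induction hypothesis applies to Pr^k(φ).
D3-iterate : ∀ {S Pr n k} → D3 S Pr n (n + k) → ∀ j → D3 S Pr n (n + j * k)
D3-iterate {n = n} d3 zero φ rewrite +-identityʳ n = ⇒I (hyp (here refl))
D3-iterate {S} {Pr} {n} {k} d3 (suc j) φ = ⇒-trans (d3 φ)
  (subst₂ (λ ψ χ → S ⊢ ψ ⇒ χ) (iterate-+ Pr n k φ)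
    (trans (iterate-+ Pr (n + j * k) k φ) (cong (λ i → iterate Pr i φ) n+jk+k))
    (D3-iterate {Pr = Pr} {n} {k} d3 j (iterate Pr k φ)))
  where
  n+jk+k : (n + j * k) + k ≡ n + (k + j * k)
  n+jk+k = trans (+-assoc n (j * k) k) (cong (n +_) (+-comm (j * k) k))

Ros-iterate : ∀ {T Pr} → Ros T Pr → ∀ i φ → T ⊢ ¬∙ φ → T ⊢ ¬∙ iterate Pr i φ
Ros-iterate ros zero    φ p = p
Ros-iterate ros (suc i) φ p = ros _ (Ros-iterate ros i φ p)

-- By C, the conjunction at level i+1 implies `Pr` of the conjunction at level i, which Ros refutes
-- once the latter is refuted.
Ros-C-iterate : ∀ {T Pr} → Ros T Pr → C T Pr → ∀ i φ ψ →
  T ⊢ ¬∙ (φ ∧ ψ) → T ⊢ ¬∙ (iterate Pr i φ ∧ iterate Pr i ψ)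
Ros-C-iterate ros c zero    φ ψ p = p
Ros-C-iterate {Pr = Pr} ros c (suc i) φ ψ p =
  ⇒-trans (c (iterate Pr i φ) (iterate Pr i ψ)) (ros _ (Ros-C-iterate ros c i φ ψ p))

theorem2p11 : (S T : Theory) →
    CE S → CE T →
    Consistent S → Consistent T →
    PA ⊑ S → PA ⊑ T → S ⊑ T →
    (n k : ℕ) → 1 ≤ n → 1 ≤ k →
    (Pr : Formula) →
    IsProvabilityPredicate S T Pr → Σ₁ Pr →
    C S Pr → D3 S Pr n (n + k) →
    ¬ Ros T Pr
theorem2p11 S T _ _ _ T-con _ PA⊑T S⊑T n@(suc n′) k@(suc k′) _ _ Pr (Pr₁ , isPr) _ c d3 ros =
  T-con (⇒E T⊢¬Pr^Kσ (necessitation K T⊢σ))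
  where
  K = n * k
  -- `suc (k′ + n′ * k)` computes to `K`.
  liar = PA-liar Pr Pr₁ (k′ + n′ * k)
  σ = proj₁ liar

  σ⇔ : T ⊢ σ ⇔∙ ¬∙ iterate Pr K σ
  σ⇔ = PA⊑T _ (proj₂ liar)

  necessitation : ∀ {φ} i → T ⊢ φ → T ⊢ iterate Pr i φ
  necessitation zero    p = p
  necessitation (suc i) p = S⊑T _ (Equivalence.to (isPr _) (necessitation i p))

  refutable : T ⊢ ¬∙ (iterate Pr n σ ∧ iterate Pr (n + K) σ)
  refutable = subst (λ ψ → T ⊢ ¬∙ (iterate Pr n σ ∧ ψ)) (iterate-+ Pr n K σ)
    (Ros-C-iterate ros (λ φ ψ → S⊑T _ (c φ ψ)) n σ (iterate Pr K σ)
      -- Uncurrying σ → ¬Pr^K(σ) refutes σ ∧ Pr^K(σ), the level 0 case.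
      (⇒E (⇒-uncurry _ _ _) (∧E₁ σ⇔)))

  T⊢¬Pr^nσ : T ⊢ ¬∙ iterate Pr n σ
  -- With `n` iterations the target exponent is `n + n * k`, that is `n + K`, so Pr^n(σ) implies the
  -- refuted conjunction.
  T⊢¬Pr^nσ = ⇒-trans (⇒E (⇒-diagonal _ _) (S⊑T _ (D3-iterate {Pr = Pr} {n} {k} d3 n σ))) refutable

  T⊢¬Pr^Kσ : T ⊢ ¬∙ iterate Pr K σ
  T⊢¬Pr^Kσ = subst (λ ψ → T ⊢ ¬∙ ψ)
    -- The truncated subtraction is exact: `n ≤ n * k` because `k` is a successor.
    (trans (iterate-+ Pr (K ∸ n) n σ) (cong (λ i → iterate Pr i σ) (m∸n+n≡m (m≤m*n n k))))
    (Ros-iterate ros (K ∸ n) (iterate Pr n σ) T⊢¬Pr^nσ)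

  T⊢σ : T ⊢ σ
  T⊢σ = ⇒E (∧E₂ σ⇔) T⊢¬Pr^Kσ
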